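{- Let $n\ge 1$, let $x_1,\dots,x_n$ and $x'$ be real-valued variables and let $a_1,\dots,a_n\in\mathbb{R}$ be real scalars. Then the max-plus equation $x'=\bigoplus_{i=1}^n (x_i\otimes a_i)$ is equivalent to the formula $$\left(\bigwedge_{i=1}^n (x'-x_i\ge a_i)\right)\wedge\left(\bigvee_{i=1}^n (x'-x_i=a_i)\right),$$ i.e. for every assignment of real values to $x',x_1,\dots,x_n$, the equation holds if and only if the formula holds.
   Context: Max-plus operations: $a\oplus b=\max\{a,b\}$ and $a\otimes b=a+b$, so $\bigoplus_{i=1}^n (x_i\otimes a_i)=\max\{x_1+a_1,\dots,x_n+a_n\}$. The displayed formula is a (quantifier-free) difference logic formula: a Boolean combination of atoms of the form $y-z\sim d$ with $y,z$ real-valued variables, $\sim\in\{>,\ge\}$ and $d\in\mathbb{R}$, where an equality $y-z=d$ abbreviates $(y-z\ge d)\wedge(z-y\ge -d)$. -}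

module Defs where

open import Data.Fin.Base using (Fin)
open import Data.Nat.Base as ℕ using (ℕ; suc)
import Data.Nat.Properties as ℕ
open import Data.Product.Base using (∃-syntax; _×_; _,_)
open import Data.Rational.Base as ℚ using (ℚ; 0ℚ; ½; ∣_∣)
import Data.Rational.Properties as ℚ
open import Data.Rational.Solver using (module +-*-Solver)
open import Data.Sum.Base using (_⊎_; inj₁; inj₂)
open import Data.Vec.Base using (foldr₁; tabulate)
open import Relation.Binary.PropositionalEquality
  using (_≡_; refl; sym; trans; cong; subst)
open import Relation.Nullary.Negation using (¬_)

infix  4 _≈_ _≤_ _≥_ _<_ _>_ _⊨_
infixl 6 _+_ _-_ _⊔_ _⊕_
infixl 7 _⊗_
infix  8 -_
infixr 7 _∧_
infixr 6 _∨_

------------------------------------------------------------------------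
-- Real numbers as Cauchy sequences of rationals, up to the equality _≈_ below

Eventually : (ℕ → Set) → Set
Eventually P = ∃[ N ] ∀ n → N ℕ.≤ n → P n

Cauchy : (ℕ → ℚ) → Set
Cauchy x = ∀ ε → 0ℚ ℚ.< ε →
  ∃[ N ] ∀ m n → N ℕ.≤ m → N ℕ.≤ n → ∣ x m ℚ.- x n ∣ ℚ.< ε

record ℝ : Set where
  constructor mkℝ
  field
    seq    : ℕ → ℚ
    cauchy : Cauchy seq

open ℝ public

-- The difference tends to 0; real numbers are compared with _≈_, not _≡_.
_≈_ : ℝ → ℝ → Set
x ≈ y = ∀ ε → 0ℚ ℚ.< ε → Eventually λ n → ∣ seq x n ℚ.- seq y n ∣ ℚ.< ε

_≤_ : ℝ → ℝ → Set
x ≤ y = ∀ ε → 0ℚ ℚ.< ε → Eventually λ n → seq x n ℚ.≤ seq y n ℚ.+ ε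

_<_ : ℝ → ℝ → Set
x < y = ∃[ ε ] 0ℚ ℚ.< ε × Eventually λ n → seq x n ℚ.+ ε ℚ.≤ seq y n

_≥_ : ℝ → ℝ → Set
x ≥ y = y ≤ x

_>_ : ℝ → ℝ → Set
x > y = y < x

private
  half-pos : ∀ {ε} → 0ℚ ℚ.< ε → 0ℚ ℚ.< ½ ℚ.* ε
  half-pos {ε} 0<ε =
    subst (ℚ._< ½ ℚ.* ε) (ℚ.*-zeroʳ ½) (ℚ.*-monoʳ-<-pos ½ 0<ε)

  half+half : ∀ ε → ½ ℚ.* ε ℚ.+ ½ ℚ.* ε ≡ ε
  half+half ε = trans (sym (ℚ.*-distribʳ-+ ε ½ ½)) (ℚ.*-identityˡ ε)

  +-diff : ∀ a b c d → (a ℚ.+ b) ℚ.- (c ℚ.+ d) ≡ (a ℚ.- c) ℚ.+ (b ℚ.- d)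
  +-diff = solve 4 (λ a b c d →
      (a :+ b) :- (c :+ d) := (a :- c) :+ (b :- d)) refl
    where open +-*-Solver

  neg-diff : ∀ a b → (ℚ.- a) ℚ.- (ℚ.- b) ≡ ℚ.- (a ℚ.- b)
  neg-diff = solve 2 (λ a b → (:- a) :- (:- b) := :- (a :- b)) refl
    where open +-*-Solver

  cancel : ∀ a b → (a ℚ.- b) ℚ.+ b ≡ a
  cancel = solve 2 (λ a b → (a :- b) :+ b := a) refl
    where open +-*-Solver

  cancel′ : ∀ a b → (a ℚ.+ b) ℚ.- b ≡ a
  cancel′ = solve 2 (λ a b → (a :+ b) :- b := a) refl
    where open +-*-Solver

  swap : ∀ a b → ℚ.- (a ℚ.- b) ≡ b ℚ.- a
  swap = solve 2 (λ a b → :- (a :- b) := b :- a) refl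
    where open +-*-Solver

  p≤∣p∣ : ∀ p → p ℚ.≤ ∣ p ∣
  p≤∣p∣ p with ℚ.≤-total 0ℚ p
  ... | inj₁ 0≤p = ℚ.≤-reflexive (sym (ℚ.0≤p⇒∣p∣≡p 0≤p))
  ... | inj₂ p≤0 = ℚ.≤-trans p≤0 (ℚ.0≤∣p∣ p)

  dist⇒< : ∀ a b {ε} → ∣ a ℚ.- b ∣ ℚ.< ε → a ℚ.< ε ℚ.+ b
  dist⇒< a b {ε} h = subst (ℚ._< ε ℚ.+ b) (cancel a b)
    (ℚ.+-monoˡ-< b (ℚ.≤-<-trans (p≤∣p∣ (a ℚ.- b)) h))

  dist-sym : ∀ a b {ε} → ∣ a ℚ.- b ∣ ℚ.< ε → ∣ b ℚ.- a ∣ ℚ.< ε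
  dist-sym a b {ε} = subst (ℚ._< ε)
    (trans (sym (ℚ.∣-p∣≡∣p∣ (a ℚ.- b))) (cong ∣_∣ (swap a b)))

  <⇒diff : ∀ a b ε → a ℚ.< ε ℚ.+ b → a ℚ.- b ℚ.< ε
  <⇒diff a b ε h =
    subst (a ℚ.- b ℚ.<_) (cancel′ ε b) (ℚ.+-monoˡ-< (ℚ.- b) h)

  <⇒dist : ∀ a b ε → a ℚ.< ε ℚ.+ b → b ℚ.< ε ℚ.+ a → ∣ a ℚ.- b ∣ ℚ.< ε
  <⇒dist a b ε h k with ℚ.∣p∣≡p∨∣p∣≡-p (a ℚ.- b)
  ... | inj₁ e = subst (ℚ._< ε) (sym e) (<⇒diff a b ε h)
  ... | inj₂ e = subst (ℚ._< ε) (sym (trans e (swap a b))) (<⇒diff b a ε k)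

  ⊔-mono-<+ : ∀ a b c d ε → a ℚ.< ε ℚ.+ c → b ℚ.< ε ℚ.+ d →
              a ℚ.⊔ b ℚ.< ε ℚ.+ (c ℚ.⊔ d)
  ⊔-mono-<+ a b c d ε h k with ℚ.⊔-sel a b
  ... | inj₁ e rewrite e = ℚ.<-≤-trans h (ℚ.+-monoʳ-≤ ε (ℚ.p≤p⊔q c d))
  ... | inj₂ e rewrite e = ℚ.<-≤-trans k (ℚ.+-monoʳ-≤ ε (ℚ.p≤q⊔p c d))

  +-dist : ∀ a b c d {δ η} → ∣ a ℚ.- c ∣ ℚ.< δ → ∣ b ℚ.- d ∣ ℚ.< η →
           ∣ (a ℚ.+ b) ℚ.- (c ℚ.+ d) ∣ ℚ.< δ ℚ.+ η
  +-dist a b c d {δ} {η} h k = subst (λ t → ∣ t ∣ ℚ.< δ ℚ.+ η)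
    (sym (+-diff a b c d))
    (ℚ.≤-<-trans (ℚ.∣p+q∣≤∣p∣+∣q∣ (a ℚ.- c) (b ℚ.- d)) (ℚ.+-mono-< h k))

  ⊔-dist : ∀ a b c d {ε} → ∣ a ℚ.- c ∣ ℚ.< ε → ∣ b ℚ.- d ∣ ℚ.< ε →
           ∣ (a ℚ.⊔ b) ℚ.- (c ℚ.⊔ d) ∣ ℚ.< ε
  ⊔-dist a b c d {ε} h k = <⇒dist (a ℚ.⊔ b) (c ℚ.⊔ d) ε
    (⊔-mono-<+ a b c d ε (dist⇒< a c h) (dist⇒< b d k))
    (⊔-mono-<+ c d a b ε
      (dist⇒< c a (dist-sym a c h)) (dist⇒< d b (dist-sym b d k)))

_+_ : ℝ → ℝ → ℝ
seq (x + y) n = seq x n ℚ.+ seq y n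
cauchy (x + y) ε 0<ε
  with cauchy x (½ ℚ.* ε) (half-pos 0<ε) | cauchy y (½ ℚ.* ε) (half-pos 0<ε)
... | M , p | N , q = M ℕ.⊔ N , λ m n M⊔N≤m M⊔N≤n →
  subst (∣ seq (x + y) m ℚ.- seq (x + y) n ∣ ℚ.<_) (half+half ε) (
  +-dist (seq x m) (seq y m) (seq x n) (seq y n)
    (p m n (ℕ.m⊔n≤o⇒m≤o M N M⊔N≤m) (ℕ.m⊔n≤o⇒m≤o M N M⊔N≤n))
    (q m n (ℕ.m⊔n≤o⇒n≤o M N M⊔N≤m) (ℕ.m⊔n≤o⇒n≤o M N M⊔N≤n)))

-_ : ℝ → ℝ
seq (- x) n = ℚ.- seq x n
cauchy (- x) ε 0<ε with cauchy x ε 0<ε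
... | N , p = N , λ m n N≤m N≤n →
  subst (ℚ._< ε)
    (sym (trans (cong ∣_∣ (neg-diff (seq x m) (seq x n)))
                (ℚ.∣-p∣≡∣p∣ (seq x m ℚ.- seq x n))))
    (p m n N≤m N≤n)

_-_ : ℝ → ℝ → ℝ
x - y = x + (- y)

_⊔_ : ℝ → ℝ → ℝ
seq (x ⊔ y) n = seq x n ℚ.⊔ seq y n
cauchy (x ⊔ y) ε 0<ε with cauchy x ε 0<ε | cauchy y ε 0<ε
... | M , p | N , q = M ℕ.⊔ N , λ m n M⊔N≤m M⊔N≤n →
  ⊔-dist (seq x m) (seq y m) (seq x n) (seq y n)
    (p m n (ℕ.m⊔n≤o⇒m≤o M N M⊔N≤m) (ℕ.m⊔n≤o⇒m≤o M N M⊔N≤n))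
    (q m n (ℕ.m⊔n≤o⇒n≤o M N M⊔N≤m) (ℕ.m⊔n≤o⇒n≤o M N M⊔N≤n))

------------------------------------------------------------------------
-- Max-plus operations

-- The iterated operation f 0 ∙ (f 1 ∙ (… ∙ f n)) over a nonempty index set.
fold⁺ : ∀ {A : Set} {n} → (A → A → A) → (Fin (suc n) → A) → A
fold⁺ _∙_ f = foldr₁ _∙_ (tabulate f)

_⊕_ : ℝ → ℝ → ℝ
a ⊕ b = a ⊔ b

_⊗_ : ℝ → ℝ → ℝ
a ⊗ b = a + b

⨁ : ∀ {n} → (Fin (suc n) → ℝ) → ℝ
⨁ = fold⁺ _⊕_

------------------------------------------------------------------------
-- Difference logic over a type V of variables

private
  variable
    V : Set

data Comparison : Set where
  gt ge : Comparison

data Formula (V : Set) : Set where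
  atom    : (y z : V) → Comparison → (d : ℝ) → Formula V
  not     : Formula V → Formula V
  _∧_ _∨_ : Formula V → Formula V → Formula V

diff≥ diff≡ : V → V → ℝ → Formula V
diff≥ y z d = atom y z ge d
diff≡ y z d = diff≥ y z d ∧ diff≥ z y (- d)

⋀ ⋁ : ∀ {n} → (Fin (suc n) → Formula V) → Formula V
⋀ = fold⁺ _∧_
⋁ = fold⁺ _∨_

_⊨_ : (V → ℝ) → Formula V → Set
ν ⊨ atom y z gt d = ν y - ν z > d
ν ⊨ atom y z ge d = ν y - ν z ≥ d
ν ⊨ not φ         = ¬ (ν ⊨ φ)
ν ⊨ (φ ∧ ψ)       = (ν ⊨ φ) × (ν ⊨ ψ)
ν ⊨ (φ ∨ ψ)       = (ν ⊨ φ) ⊎ (ν ⊨ ψ)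

data Var (n : ℕ) : Set where
  x′   : Var n
  x[_] : Fin n → Var n

{-# OPTIONS --safe #-}

-- The conjunction says that x′ is an upper bound of the terms xᵢ + aᵢ, and the
-- disjunction that it equals one of them.  The maximum has both properties; that
-- it is attained follows from totality of the order on ℝ, which is the only
-- place where excluded middle enters.
module Submission where

open import Defs
open import Axiom.ExcludedMiddle using (ExcludedMiddle)
open import Data.Fin.Base using (Fin; zero; suc)
open import Data.Fin.Properties using (∀-cons; ⊎⇔∃)
open import Data.Nat.Base as ℕ using (ℕ; zero; suc)
import Data.Nat.Properties as ℕ
open import Data.Product.Base using (∃-syntax; _×_; _,_)
open import Data.Rational.Base as ℚ using (0ℚ; ½; ∣_∣)
import Data.Rational.Properties as ℚ
open import Data.Rational.Solver using (module +-*-Solver)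
open import Data.Sum.Base as Sum using (_⊎_; inj₁; inj₂)
open import Function.Base using (_∘_; case_of_)
open import Function.Bundles using (_⇔_; mk⇔; Equivalence)
open import Level using (0ℓ)
open import Relation.Binary.PropositionalEquality
  using (_≡_; refl; sym; trans; cong; subst; subst₂)
open import Relation.Nullary.Decidable.Core using (yes; no; decidable-stable)
open import Relation.Nullary.Negation using (¬_)

open Equivalence using (to; from)
open +-*-Solver

private
  variable
    V : Set

-- Serves to rearrange rational inequalities: `t` is added to both sides, and the two equations,
-- mostly ring identities, bring the results to the wanted form.
≤-shift : ∀ {p q r s} t → p ℚ.+ t ≡ r → q ℚ.+ t ≡ s → p ℚ.≤ q → r ℚ.≤ s
≤-shift t p+t≡r q+t≡s p≤q = subst₂ ℚ._≤_ p+t≡r q+t≡s (ℚ.+-monoˡ-≤ t p≤q)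

p≤∣p∣ : ∀ p → p ℚ.≤ ∣ p ∣
p≤∣p∣ p with ℚ.≤-total 0ℚ p
... | inj₁ 0≤p = ℚ.≤-reflexive (sym (ℚ.0≤p⇒∣p∣≡p 0≤p))
... | inj₂ p≤0 = ℚ.≤-trans p≤0 (ℚ.0≤∣p∣ p)

∣p-q∣≤r⇒p≤q+r : ∀ p q {r} → ∣ p ℚ.- q ∣ ℚ.≤ r → p ℚ.≤ q ℚ.+ r
∣p-q∣≤r⇒p≤q+r p q {r} h = ≤-shift q
  (solve 2 (λ p q → (p :- q) :+ q := p) refl p q) (ℚ.+-comm r q)
  (ℚ.≤-trans (p≤∣p∣ (p ℚ.- q)) h)

∣p-q∣≡∣q-p∣ : ∀ p q → ∣ p ℚ.- q ∣ ≡ ∣ q ℚ.- p ∣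
∣p-q∣≡∣q-p∣ p q = trans (sym (ℚ.∣-p∣≡∣p∣ (p ℚ.- q)))
  (cong ∣_∣ (solve 2 (λ p q → :- (p :- q) := q :- p) refl p q))

p≤q+r∧q≤p+r⇒∣p-q∣≤r : ∀ p q {r} → p ℚ.≤ q ℚ.+ r → q ℚ.≤ p ℚ.+ r →
                      ∣ p ℚ.- q ∣ ℚ.≤ r
p≤q+r∧q≤p+r⇒∣p-q∣≤r p q {r} h k with ℚ.∣p∣≡p∨∣p∣≡-p (p ℚ.- q)
... | inj₁ e = subst (ℚ._≤ r) (sym e)
  (≤-shift (ℚ.- q) refl (solve 2 (λ q r → (q :+ r) :- q := r) refl q r) h)
... | inj₂ e = subst (ℚ._≤ r) (sym e)
  (≤-shift (ℚ.- p) (solve 2 (λ p q → q :- p := :- (p :- q)) refl p q)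
                   (solve 2 (λ p r → (p :+ r) :- p := r) refl p r) k)

0<½ε : ∀ {ε} → 0ℚ ℚ.< ε → 0ℚ ℚ.< ½ ℚ.* ε
0<½ε {ε} 0<ε =
  subst (ℚ._< ½ ℚ.* ε) (ℚ.*-zeroʳ ½) (ℚ.*-monoʳ-<-pos ½ 0<ε)

½ε+½ε≡ε : ∀ ε → ½ ℚ.* ε ℚ.+ ½ ℚ.* ε ≡ ε
½ε+½ε≡ε ε = trans (sym (ℚ.*-distribʳ-+ ε ½ ½)) (ℚ.*-identityˡ ε)

½ε<ε : ∀ {ε} → 0ℚ ℚ.< ε → ½ ℚ.* ε ℚ.< ε
½ε<ε {ε} 0<ε = subst₂ ℚ._<_ (ℚ.+-identityʳ (½ ℚ.* ε)) (½ε+½ε≡ε ε)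
  (ℚ.+-monoʳ-< (½ ℚ.* ε) (0<½ε 0<ε))

p≤p+ε : ∀ p {ε} → 0ℚ ℚ.< ε → p ℚ.≤ p ℚ.+ ε
p≤p+ε p {ε} 0<ε =
  subst (ℚ._≤ p ℚ.+ ε) (ℚ.+-identityʳ p) (ℚ.+-monoʳ-≤ p (ℚ.<⇒≤ 0<ε))

Eventually-map : ∀ {P Q : ℕ → Set} → (∀ n → P n → Q n) →
                 Eventually P → Eventually Q
Eventually-map f (N , p) = N , λ n N≤n → f n (p n N≤n)

Eventually-zip : ∀ {P Q R : ℕ → Set} → (∀ n → P n → Q n → R n) →
                 Eventually P → Eventually Q → Eventually R
Eventually-zip f (M , p) (N , q) = M ℕ.⊔ N , λ n M⊔N≤n →
  f n (p n (ℕ.m⊔n≤o⇒m≤o M N M⊔N≤n)) (q n (ℕ.m⊔n≤o⇒n≤o M N M⊔N≤n))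

-- Real arguments of order lemmas are explicit because the relations unfold to
-- statements about sequences, from which the real numbers cannot be inferred.

≤-pointwise : ∀ x y → (∀ n → seq x n ℚ.≤ seq y n) → x ≤ y
≤-pointwise x y h ε 0<ε = 0 , λ n _ →
  ℚ.≤-trans (h n) (p≤p+ε (seq y n) 0<ε)

≤-refl : ∀ x → x ≤ x
≤-refl x = ≤-pointwise x x (λ _ → ℚ.≤-refl)

≤-trans : ∀ x y z → x ≤ y → y ≤ z → x ≤ z
≤-trans x y z x≤y y≤z ε 0<ε =
  Eventually-zip step (x≤y ½ε (0<½ε 0<ε)) (y≤z ½ε (0<½ε 0<ε))
  where
  ½ε = ½ ℚ.* ε
  step : ∀ n → seq x n ℚ.≤ seq y n ℚ.+ ½ε → seq y n ℚ.≤ seq z n ℚ.+ ½ε →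
         seq x n ℚ.≤ seq z n ℚ.+ ε
  step n h k = ℚ.≤-trans h (≤-shift ½ε refl
    (trans (ℚ.+-assoc (seq z n) ½ε ½ε) (cong (seq z n ℚ.+_) (½ε+½ε≡ε ε))) k)

≈⇒≤ : ∀ x y → x ≈ y → x ≤ y
≈⇒≤ x y x≈y ε 0<ε =
  Eventually-map (λ n → ∣p-q∣≤r⇒p≤q+r (seq x n) (seq y n) ∘ ℚ.<⇒≤) (x≈y ε 0<ε)

≈⇒≥ : ∀ x y → x ≈ y → y ≤ x
≈⇒≥ x y x≈y = ≈⇒≤ y x λ ε 0<ε → Eventually-map
  (λ n → subst (ℚ._< ε) (∣p-q∣≡∣q-p∣ (seq x n) (seq y n))) (x≈y ε 0<ε)

≤-antisym : ∀ x y → x ≤ y → y ≤ x → x ≈ y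
-- `≈` asks for a strict bound while the hypotheses give non-strict ones, so they are taken at half
-- of `ε`.
≤-antisym x y x≤y y≤x ε 0<ε = Eventually-zip
  (λ n h k → ℚ.≤-<-trans
    (p≤q+r∧q≤p+r⇒∣p-q∣≤r (seq x n) (seq y n) h k) (½ε<ε 0<ε))
  (x≤y (½ ℚ.* ε) (0<½ε 0<ε)) (y≤x (½ ℚ.* ε) (0<½ε 0<ε))

-- Beyond N the difference y - x stays within ε of its value at m.
≤-cofinal : ∀ x y → (∀ N → ∃[ m ] N ℕ.≤ m × seq y m ℚ.≤ seq x m) → y ≤ x
≤-cofinal x y often ε 0<ε =
  let N , close         = cauchy (y - x) ε 0<ε
      m , N≤m , ym≤xm   = often N
  in  N , λ n N≤n → bound (seq x n) (seq y n) (seq x m) (seq y m)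
                      ym≤xm (ℚ.<⇒≤ (close n m N≤n N≤m))
  where
  bound : ∀ p q r s → s ℚ.≤ r → ∣ (q ℚ.- p) ℚ.- (s ℚ.- r) ∣ ℚ.≤ ε →
          q ℚ.≤ p ℚ.+ ε
  bound p q r s s≤r h = ≤-shift p
    (solve 2 (λ p q → (q :- p) :+ p := q) refl p q) (ℚ.+-comm ε p)
    (ℚ.≤-trans (∣p-q∣≤r⇒p≤q+r (q ℚ.- p) (s ℚ.- r) h)
      (≤-shift (ε ℚ.- r)
        (solve 3 (λ r s e → s :+ (e :- r) := (s :- r) :+ e) refl r s ε)
        (solve 2 (λ r e → r :+ (e :- r) := e) refl r ε) s≤r))

-- If `x ≤ y` fails, then `seq y m ≤ seq x m` for arbitrarily late `m`; the Cauchy property, through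
-- `≤-cofinal`, spreads this to all late indices up to any `ε`.
≤-total : ExcludedMiddle 0ℓ → ∀ x y → x ≤ y ⊎ y ≤ x
≤-total em x y = case em of λ where
    (yes x≤y) → inj₁ x≤y
    (no  x≰y) → inj₂ (≤-cofinal x y (often x≰y))
  where
  often : ¬ (x ≤ y) → ∀ N → ∃[ m ] N ℕ.≤ m × seq y m ℚ.≤ seq x m
  -- The index is found by contradiction: if none existed beyond `N`, then `seq x` would stay
  -- strictly below `seq y` from `N` on, giving `x ≤ y` with the same threshold `N` for every `ε`.
  often x≰y N = decidable-stable em λ y>x → x≰y λ ε 0<ε → N , λ n N≤n →
    ℚ.≤-trans (ℚ.<⇒≤ (ℚ.≰⇒> λ yn≤xn → y>x (n , N≤n , yn≤xn)))
              (p≤p+ε (seq y n) 0<ε)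

x≤x⊔y : ∀ x y → x ≤ x ⊔ y
x≤x⊔y x y = ≤-pointwise x (x ⊔ y) (λ n → ℚ.p≤p⊔q (seq x n) (seq y n))

y≤x⊔y : ∀ x y → y ≤ x ⊔ y
y≤x⊔y x y = ≤-pointwise y (x ⊔ y) (λ n → ℚ.p≤q⊔p (seq x n) (seq y n))

⊔-lub : ∀ x y z → x ≤ z → y ≤ z → x ⊔ y ≤ z
⊔-lub x y z x≤z y≤z ε 0<ε =
  Eventually-zip (λ _ → ℚ.⊔-lub) (x≤z ε 0<ε) (y≤z ε 0<ε)

-- At each index the two inequalities differ by the shift `seq x n`, so the same `ε` and the same
-- threshold serve both.
y-x≥a⇔x+a≤y : ∀ x y a → y - x ≥ a ⇔ x + a ≤ y
y-x≥a⇔x+a≤y x y a = mk⇔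
  (λ h ε 0<ε → Eventually-map (λ n → ≤-shift (seq x n)
    (ℚ.+-comm (seq a n) (seq x n))
    (solve 3 (λ x y e → ((y :- x) :+ e) :+ x := y :+ e) refl
      (seq x n) (seq y n) ε))
    (h ε 0<ε))
  (λ h ε 0<ε → Eventually-map (λ n → ≤-shift (ℚ.- seq x n)
    (solve 2 (λ x a → (x :+ a) :- x := a) refl (seq x n) (seq a n))
    (solve 3 (λ x y e → (y :+ e) :- x := (y :- x) :+ e) refl
      (seq x n) (seq y n) ε))
    (h ε 0<ε))

-- Handles the reversed atom in `diff≡`; here the shift is `seq y n + seq a n`.
x-y≥-a⇔y≤x+a : ∀ x y a → x - y ≥ - a ⇔ y ≤ x + a
x-y≥-a⇔y≤x+a x y a = mk⇔
  (λ h ε 0<ε → Eventually-map (λ n → ≤-shift (seq y n ℚ.+ seq a n)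
    (solve 2 (λ y a → :- a :+ (y :+ a) := y) refl (seq y n) (seq a n))
    (solve 4 (λ x y a e → ((x :- y) :+ e) :+ (y :+ a) := (x :+ a) :+ e) refl
      (seq x n) (seq y n) (seq a n) ε))
    (h ε 0<ε))
  (λ h ε 0<ε → Eventually-map (λ n → ≤-shift (ℚ.- (seq y n ℚ.+ seq a n))
    (solve 2 (λ y a → y :- (y :+ a) := :- a) refl (seq y n) (seq a n))
    (solve 4 (λ x y a e → ((x :+ a) :+ e) :- (y :+ a) := (x :- y) :+ e) refl
      (seq x n) (seq y n) (seq a n) ε))
    (h ε 0<ε))

fᵢ≤⨁f : ∀ {n} (f : Fin (suc n) → ℝ) i → f i ≤ ⨁ f
fᵢ≤⨁f {zero}  f zero    = ≤-refl (f zero)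
fᵢ≤⨁f {suc _} f zero    = x≤x⊔y (f zero) (⨁ (f ∘ suc))
fᵢ≤⨁f {suc _} f (suc i) = ≤-trans (f (suc i)) (⨁ (f ∘ suc)) (⨁ f)
  (fᵢ≤⨁f (f ∘ suc) i) (y≤x⊔y (f zero) (⨁ (f ∘ suc)))

⨁-lub : ∀ {n} (f : Fin (suc n) → ℝ) y → (∀ i → f i ≤ y) → ⨁ f ≤ y
⨁-lub {zero}  f y f≤y = f≤y zero
⨁-lub {suc _} f y f≤y = ⊔-lub (f zero) (⨁ (f ∘ suc)) y
  (f≤y zero) (⨁-lub (f ∘ suc) y (f≤y ∘ suc))

-- By induction, comparing the first term with the maximum of the rest: the larger of the two
-- decides whether the index comes from the tail or is `zero`. The opposite inequality is `fᵢ≤⨁f`.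
⨁-attained : ExcludedMiddle 0ℓ → ∀ {n} (f : Fin (suc n) → ℝ) →
             ∃[ i ] ⨁ f ≤ f i
⨁-attained em {zero}  f = zero , ≤-refl (f zero)
⨁-attained em {suc _} f
  with ⨁-attained em (f ∘ suc) | ≤-total em (f zero) (⨁ (f ∘ suc))
... | i , M≤fᵢ | inj₁ f₀≤M = suc i , ⊔-lub (f zero) M (f (suc i))
        (≤-trans (f zero) M (f (suc i)) f₀≤M M≤fᵢ) M≤fᵢ
  where M = ⨁ (f ∘ suc)
... | _ | inj₂ M≤f₀ = zero ,
        ⊔-lub (f zero) (⨁ (f ∘ suc)) (f zero) (≤-refl (f zero)) M≤f₀

-- `fold⁺` has no unit element: over a single index it reduces to the formula itself, which is the
-- base case here and in `⊨-⋁`.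
⊨-⋀ : ∀ {n} (ν : V → ℝ) (φ : Fin (suc n) → Formula V) →
      ν ⊨ ⋀ φ ⇔ (∀ i → ν ⊨ φ i)
⊨-⋀ {n = zero}  ν φ = mk⇔ (λ { h zero → h }) (λ h → h zero)
⊨-⋀ {n = suc _} ν φ = mk⇔
  (λ (h , t) → ∀-cons h (to (⊨-⋀ ν (φ ∘ suc)) t))
  (λ h → h zero , from (⊨-⋀ ν (φ ∘ suc)) (h ∘ suc))

⊨-⋁ : ∀ {n} (ν : V → ℝ) (φ : Fin (suc n) → Formula V) →
      ν ⊨ ⋁ φ ⇔ (∃[ i ] ν ⊨ φ i)
⊨-⋁ {n = zero}  ν φ = mk⇔ (zero ,_) (λ { (zero , h) → h })
⊨-⋁ {n = suc _} ν φ = mk⇔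
  (λ h → to ⊎⇔∃ (Sum.map₂ (to (⊨-⋁ ν (φ ∘ suc))) h))
  (λ h → Sum.map₂ (from (⊨-⋁ ν (φ ∘ suc))) (from ⊎⇔∃ h))

proposition9 : ExcludedMiddle 0ℓ →
    ∀ (n : ℕ) (a : Fin (suc n) → ℝ) (ν : Var (suc n) → ℝ) →
    (ν x′ ≈ ⨁ (λ i → ν x[ i ] ⊗ a i))
    ⇔ (ν ⊨ (⋀ (λ i → diff≥ x′ x[ i ] (a i)) ∧ ⋁ (λ i → diff≡ x′ x[ i ] (a i))))
proposition9 em n a ν = mk⇔ equation⇒formula formula⇒equation
  where
  y : ℝ
  y = ν x′

  f : Fin (suc n) → ℝ
  f i = ν x[ i ] ⊗ a i

  M : ℝ
  M = ⨁ f

  φ≥ φ≡ : Fin (suc n) → Formula (Var (suc n))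
  φ≥ i = diff≥ x′ x[ i ] (a i)
  φ≡ i = diff≡ x′ x[ i ] (a i)

  lower : ∀ i → ν ⊨ diff≥ x′ x[ i ] (a i) ⇔ f i ≤ y
  lower i = y-x≥a⇔x+a≤y (ν x[ i ]) y (a i)

  upper : ∀ i → ν ⊨ diff≥ x[ i ] x′ (- a i) ⇔ y ≤ f i
  upper i = x-y≥-a⇔y≤x+a (ν x[ i ]) y (a i)

  equation⇒formula : y ≈ M → ν ⊨ (⋀ φ≥ ∧ ⋁ φ≡)
  equation⇒formula y≈M =
    let f≤y      = λ i → ≤-trans (f i) M y (fᵢ≤⨁f f i) (≈⇒≥ y M y≈M)
        -- An index attaining the maximum is the witness for the disjunction.
        i , M≤fᵢ = ⨁-attained em f
        y≤fᵢ     = ≤-trans y M (f i) (≈⇒≤ y M y≈M) M≤fᵢ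
    in  from (⊨-⋀ ν φ≥) (λ j → from (lower j) (f≤y j))
      , from (⊨-⋁ ν φ≡) (i , from (lower i) (f≤y i) , from (upper i) y≤fᵢ)

  formula⇒equation : ν ⊨ (⋀ φ≥ ∧ ⋁ φ≡) → y ≈ M
  formula⇒equation (all≥ , some≡) =
    let f≤y             = λ j → to (lower j) (to (⊨-⋀ ν φ≥) all≥ j)
        i , _ , atom≤fᵢ = to (⊨-⋁ ν φ≡) some≡
    -- The true disjunct bounds `y` by the single term `f i`, hence by `M`; the conjunction makes
    -- `y` an upper bound of all terms, hence of `M`.
    in  ≤-antisym y M
          (≤-trans y (f i) M (to (upper i) atom≤fᵢ) (fᵢ≤⨁f f i))
          (⨁-lub f y f≤y)
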